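{- Let $\lambda$ be a regular cardinal with $\lambda>\aleph_0$, and let $D$ be a filter on $\lambda$ which extends the club filter on $\lambda$ (i.e. every closed unbounded subset of $\lambda$ belongs to $D$). Let $\mathcal{M}$ and $\mathcal{N}$ be structures in the same vocabulary. If $\mathcal{M}$ and $\mathcal{N}$ are $EF_\lambda$-equivalent, then the reduced powers $\mathcal{M}^\lambda/D$ and $\mathcal{N}^\lambda/D$ are $EF_{\lambda^+}$-equivalent.
   Context: For an ordinal $\alpha$, two structures $\mathcal{A},\mathcal{B}$ in the same vocabulary are called $EF_\alpha$-equivalent if the second player (the "isomorphism" player, II) has a winning strategy in the Ehrenfeucht-Fraïssé game of length $\alpha$ on $\mathcal{A}$ and $\mathcal{B}$. In this game there are $\alpha$ rounds; in each round player I picks an element of one of the two structures and player II responds with an element of the other structure. Player II wins if the resulting correspondence between the elements chosen in $\mathcal{A}$ and the elements chosen in $\mathcal{B}$ is a partial isomorphism (it preserves atomic formulas in both directions). $\mathcal{M}^\lambda/D$ denotes the reduced power of $\mathcal{M}$ modulo the filter $D$. -}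

module Defs where

open import Level using (Level; Lift; _⊔_) renaming (suc to ℓsuc)
open import Data.Nat.Base using (ℕ; zero; suc)
open import Data.Fin.Base using (Fin; zero; suc)
open import Data.Product.Base using (_×_; _,_; ∃; ∃-syntax)
open import Function.Base using (_∘_)
open import Function.Bundles using (_↣_; _⇔_)
open import Function.Definitions using (Injective)
open import Induction.WellFounded using (WellFounded)
open import Relation.Binary.Bundles using (Setoid)
open import Relation.Binary.Core using (Rel)
open import Relation.Binary.PropositionalEquality.Core using (_≡_)
open import Relation.Binary.Structures using (IsStrictTotalOrder)
open import Relation.Nullary.Negation.Core using (¬_)
open import Relation.Unary using (Pred; _∈_; _∉_; _⊆_; _∩_)
open import Relation.Unary.Polymorphic using (∅; U)

-- An ordinal is represented by a well-ordered type of that order type, and a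
-- cardinal by its initial ordinal.

record WellOrder a : Set (ℓsuc a) where
  infix 4 _<_
  field
    Carrier            : Set a
    _<_                : Rel Carrier a
    isStrictTotalOrder : IsStrictTotalOrder _≡_ _<_
    wellFounded        : WellFounded _<_

infix 4 _≺_

_≺_ : ∀ {a b} → Set a → Set b → Set (a ⊔ b)
A ≺ B = (A ↣ B) × ¬ (B ↣ A)

module _ {l} (L : WellOrder l) where
  open WellOrder L

  -- There is no injection of the whole order into a proper initial segment.
  -- Segments {y | y < x} are never formed as Σ-types here, because proofs of
  -- y < x need not be unique.

  IsCardinal : Set l
  IsCardinal =
    ∀ x → ¬ (∃ λ (f : Carrier → Carrier) → Injective _≡_ _≡_ f × (∀ y → f y < x))

  -- An infinite cardinal with no cofinal map from a smaller ordinal. Maps on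
  -- {y | y < x} are taken to be restrictions of total maps; this loses nothing
  -- classically as the target is inhabited.

  record IsRegularCardinal : Set l where
    field
      isCardinal : IsCardinal
      infinite   : ℕ ↣ Carrier
      regular    : ∀ x (f : Carrier → Carrier) → ∃[ b ] (∀ y → y < x → f y < b)

  IsUnbounded : ∀ {ℓ} → Pred Carrier ℓ → Set (l ⊔ ℓ)
  IsUnbounded C = ∀ x → ∃[ y ] x < y × y ∈ C

  -- The requirement that something lie below δ keeps 0 from counting as a
  -- limit of points of C.

  IsClosed : ∀ {ℓ} → Pred Carrier ℓ → Set (l ⊔ ℓ)
  IsClosed C =
    ∀ δ → (∃[ x ] x < δ) → (∀ x → x < δ → ∃[ y ] x < y × y < δ × y ∈ C) → δ ∈ C

  IsClub : ∀ {ℓ} → Pred Carrier ℓ → Set (l ⊔ ℓ)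
  IsClub C = IsClosed C × IsUnbounded C

-- K is the least cardinal above L: every ordinal below K has cardinality at
-- most that of L.

record IsSuccessorCardinal {l k} (L : WellOrder l) (K : WellOrder k) : Set (l ⊔ k) where
  private
    module L = WellOrder L
    module K = WellOrder K
  field
    isCardinal : IsCardinal K
    above      : L.Carrier ≺ K.Carrier
    least      : ∀ x → ∃ λ (f : K.Carrier → L.Carrier) →
                   ∀ {y z} → y K.< x → z K.< x → f y ≡ f z → y ≡ z

record Filter {a} (X : Set a) (ℓ d : Level) : Set (a ⊔ ℓsuc (ℓ ⊔ d)) where
  field
    sets     : Pred (Pred X ℓ) d
    U∈       : U ∈ sets
    ∅∉       : ∅ ∉ sets
    ∩-closed : ∀ {S T} → S ∈ sets → T ∈ sets → (S ∩ T) ∈ sets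
    ⊆-closed : ∀ {S T} → S ⊆ T → S ∈ sets → T ∈ sets

  ⋂-closed : ∀ n {S : Fin n → Pred X ℓ} →
             (∀ i → S i ∈ sets) → (λ x → ∀ i → S i x) ∈ sets
  ⋂-closed zero     _ = ⊆-closed (λ _ ()) U∈
  ⋂-closed (suc n) S∈ =
    ⊆-closed (λ { (s , _) zero → s ; (_ , t) (suc i) → t i })
             (∩-closed (S∈ zero) (⋂-closed n (S∈ ∘ suc)))

ExtendsClubFilter : ∀ {l ℓ d} (L : WellOrder l) →
                    Filter (WellOrder.Carrier L) ℓ d → Set (l ⊔ ℓsuc ℓ ⊔ d)
ExtendsClubFilter L D = ∀ C → IsClub L C → C ∈ Filter.sets D

record Vocabulary v : Set (ℓsuc v) where
  field
    FunSym : Set v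
    RelSym : Set v
    funAr  : FunSym → ℕ
    relAr  : RelSym → ℕ

-- The underlying set of a structure is the setoid (Carrier, _≈_), so that a
-- reduced power is a structure without forming a quotient type.

record Structure {v} (V : Vocabulary v) c r : Set (v ⊔ ℓsuc (c ⊔ r)) where
  open Vocabulary V
  field
    setoid : Setoid c r
  open Setoid setoid public
  field
    fun      : (F : FunSym) → (Fin (funAr F) → Carrier) → Carrier
    fun-cong : ∀ F {xs ys} → (∀ i → xs i ≈ ys i) → fun F xs ≈ fun F ys
    rel      : (R : RelSym) → (Fin (relAr R) → Carrier) → Set r
    rel-cong : ∀ R {xs ys} → (∀ i → xs i ≈ ys i) → rel R xs → rel R ys

module _ {v} (V : Vocabulary v) where
  open Vocabulary V

  data Term {x} (X : Set x) : Set (v ⊔ x) where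
    var : X → Term X
    app : (F : FunSym) → (Fin (funAr F) → Term X) → Term X

  data Atomic {x} (X : Set x) : Set (v ⊔ x) where
    _≐_  : Term X → Term X → Atomic X
    atom : (R : RelSym) → (Fin (relAr R) → Term X) → Atomic X

module _ {v} {V : Vocabulary v} {c r} (M : Structure V c r) where
  open Structure M

  eval : ∀ {x} {X : Set x} → (X → Carrier) → Term V X → Carrier
  eval a (var x)    = a x
  eval a (app F ts) = fun F (λ i → eval a (ts i))

  infix 4 _⊨_[_]

  _⊨_[_] : ∀ {x} {X : Set x} → Atomic V X → (X → Carrier) → Set r
  _⊨_[_] (s ≐ t)     a = eval a s ≈ eval a t
  _⊨_[_] (atom R ts) a = rel R (λ i → eval a (ts i))

module _ {v} {V : Vocabulary v} {a c r d} {X : Set a}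
         (D : Filter X r d) (M : Structure V c r) where
  private module M = Structure M
  open Filter D

  reducedPower : Structure V (a ⊔ c) d
  reducedPower = record
    { setoid = record
      { Carrier       = X → M.Carrier
      ; _≈_           = λ f g → (λ ξ → f ξ M.≈ g ξ) ∈ sets
      ; isEquivalence = record
        { refl  = ⊆-closed (λ _ → M.refl) U∈
        ; sym   = ⊆-closed M.sym
        ; trans = λ p q → ⊆-closed (λ (e , e′) → M.trans e e′) (∩-closed p q)
        }
      }
    ; fun      = λ F fs ξ → M.fun F (λ i → fs i ξ)
    ; fun-cong = λ F es → ⊆-closed (M.fun-cong F) (⋂-closed _ es)
    ; rel      = λ R fs → (λ ξ → M.rel R (λ i → fs i ξ)) ∈ sets
    ; rel-cong = λ R es p →
        ⊆-closed (λ (e , h) → M.rel-cong R e h) (∩-closed (⋂-closed _ es) p)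
    }

-- The Ehrenfeucht–Fraïssé game with rounds indexed by the elements of A.

module EF {v} {V : Vocabulary v} {a c r c′ r′} (A : WellOrder a)
          (M : Structure V c r) (N : Structure V c′ r′) where
  private
    module A = WellOrder A
    module M = Structure M
    module N = Structure N

  -- In inM x y player I picks x in M and II answers y in N; in inN x y player
  -- I picks y in N and II answers x in M.

  data Round : Set (c ⊔ c′) where
    inM inN : M.Carrier → N.Carrier → Round

  data _≈ᴿ_ : Round → Round → Set (c ⊔ c′ ⊔ r ⊔ r′) where
    inM : ∀ {x x′ y y′} → x M.≈ x′ → y N.≈ y′ → inM x y ≈ᴿ inM x′ y′
    inN : ∀ {x x′ y y′} → x M.≈ x′ → y N.≈ y′ → inN x y ≈ᴿ inN x′ y′

  left : Round → M.Carrier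
  left (inM x _) = x
  left (inN x _) = x

  right : Round → N.Carrier
  right (inM _ y) = y
  right (inN _ y) = y

  History : A.Carrier → Set (a ⊔ c ⊔ c′)
  History i = ∀ j → j A.< i → Round

  _≈ᴴ_ : ∀ {i} → History i → History i → Set (a ⊔ c ⊔ c′ ⊔ r ⊔ r′)
  h ≈ᴴ h′ = ∀ j j<i → h j j<i ≈ᴿ h′ j j<i

  -- A strategy of II; the congruence fields make it a function of the actual
  -- elements (setoid classes) played.

  record Strategy : Set (a ⊔ c ⊔ c′ ⊔ r ⊔ r′) where
    field
      answerN      : ∀ i → History i → M.Carrier → N.Carrier
      answerM      : ∀ i → History i → N.Carrier → M.Carrier
      answerN-cong : ∀ i {h h′ : History i} {x x′} → h ≈ᴴ h′ → x M.≈ x′ →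
                     answerN i h x N.≈ answerN i h′ x′
      answerM-cong : ∀ i {h h′ : History i} {y y′} → h ≈ᴴ h′ → y N.≈ y′ →
                     answerM i h y M.≈ answerM i h′ y′

  Play : Set (a ⊔ c ⊔ c′)
  Play = A.Carrier → Round

  module _ (σ : Strategy) where
    open Strategy σ

    Obeys : ∀ i → History i → Round → Set (r ⊔ r′)
    Obeys i h (inM x y) = Lift r (y N.≈ answerN i h x)
    Obeys i h (inN x y) = Lift r′ (x M.≈ answerM i h y)

    Follows : Play → Set (a ⊔ r ⊔ r′)
    Follows p = ∀ i → Obeys i (λ j _ → p j) (p i)

  IsPartialIsomorphism : (A.Carrier → M.Carrier) → (A.Carrier → N.Carrier) →
                         Set (v ⊔ a ⊔ r ⊔ r′)
  IsPartialIsomorphism xs ys =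
    ∀ (φ : Atomic V A.Carrier) → (M ⊨ φ [ xs ]) ⇔ (N ⊨ φ [ ys ])

  IsWinning : Strategy → Set (v ⊔ a ⊔ c ⊔ c′ ⊔ r ⊔ r′)
  IsWinning σ = ∀ (p : Play) → Follows σ p → IsPartialIsomorphism (left ∘ p) (right ∘ p)

EFEquivalent : ∀ {v} {V : Vocabulary v} {a c r c′ r′} → WellOrder a →
               Structure V c r → Structure V c′ r′ → Set (v ⊔ a ⊔ c ⊔ c′ ⊔ r ⊔ r′)
EFEquivalent A M N = ∃[ σ ] EF.IsWinning A M N σ

{-# OPTIONS --safe #-}
-- For α < λ⁺ fix an injection code α : α → λ. At a coordinate ξ only the rounds
-- γ < α with code α γ < ξ are remembered in round α; there are fewer than λ of
-- them, so they can be placed strictly increasingly into the game of length λ on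
-- M and N, where II answers by the given strategy. For club many ξ the rounds
-- remembered in a remembered round β are exactly the rounds before β remembered
-- in α, so the positions reached at ξ cohere. An atomic formula involves finitely
-- many rounds, and all of them are remembered, from one later round, at D-many
-- coordinates.
--
-- D need not be closed under diagonal intersections, so infinitely many changes
-- of representatives modulo D cannot be absorbed. II therefore replays the moves
-- of I through canonical representatives and ignores its own past answers.
module Submission where

open import Axiom.ExcludedMiddle using (ExcludedMiddle)
open import Axiom.Extensionality.Propositional using (Extensionality)
open import Data.Bool.Base using (Bool; T)
open import Data.Fin.Base using (Fin; zero; suc)
open import Data.Nat.Base using (ℕ; zero; suc)
open import Data.Product.Base using (_×_; _,_; ∃; ∃-syntax; proj₁; proj₂)
open import Data.Sum.Base using (_⊎_; inj₁; inj₂)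
open import Data.Unit.Polymorphic.Base using (tt)
open import Defs
open import Function.Base using (_∘_; const)
open import Function.Bundles using (Injection; mk↣; mk⇔; _⇔_; module Equivalence)
open import Function.Definitions using (Injective)
open import Function.Construct.Composition using (_⇔-∘_)
open import Function.Construct.Symmetry using (⇔-sym)
open import Induction.WellFounded using (module All; module FixPoint)
open import Level using (Lift; lift; lower; _⊔_)
open import Relation.Binary.Bundles using (Setoid)
open import Relation.Binary.Definitions using (tri<; tri≈; tri>)
open import Relation.Binary.PropositionalEquality
  using (_≡_; _≢_; refl; sym; trans; cong; cong₂; subst; subst₂)
open import Relation.Binary.Structures using (IsStrictTotalOrder)
open import Relation.Nullary.Decidable
  using (yes; no; True; ⌊_⌋; toWitness; fromWitness; isYes≗does; does-⇔; decidable-stable)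
open import Relation.Nullary.Negation using (¬_; contradiction)
open import Relation.Unary using (Pred; _∈_; _⊆_)
open import Relation.Unary.Polymorphic using (U)

-- Atomic formulas: renaming of variables and truth in reduced powers.

module _ {v} {V : Vocabulary v} where
  open Vocabulary V

  renameTerm : ∀ {x y} {X : Set x} {Y : Set y} → (X → Y) → Term V X → Term V Y
  renameTerm ρ (var x)    = var (ρ x)
  renameTerm ρ (app F ts) = app F (λ i → renameTerm ρ (ts i))

  rename : ∀ {x y} {X : Set x} {Y : Set y} → (X → Y) → Atomic V X → Atomic V Y
  rename ρ (s ≐ t)     = renameTerm ρ s ≐ renameTerm ρ t
  rename ρ (atom R ts) = atom R (λ i → renameTerm ρ (ts i))

  TermOver : ∀ {x b} {X : Set x} → Pred X b → Term V X → Set b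
  TermOver B (var x)    = B x
  TermOver B (app F ts) = ∀ i → TermOver B (ts i)

  AtomicOver : ∀ {x b} {X : Set x} → Pred X b → Atomic V X → Set b
  AtomicOver B (s ≐ t)     = TermOver B s × TermOver B t
  AtomicOver B (atom R ts) = ∀ i → TermOver B (ts i)

  TermOver-mono : ∀ {x b b′} {X : Set x} {B : Pred X b} {B′ : Pred X b′} →
                  B ⊆ B′ → ∀ t → TermOver B t → TermOver B′ t
  TermOver-mono B⊆B′ (var x)    b = B⊆B′ b
  TermOver-mono B⊆B′ (app F ts) b = λ i → TermOver-mono B⊆B′ (ts i) (b i)

  module _ {c r} (M : Structure V c r) where
    open Structure M renaming (refl to ≈-refl; sym to ≈-sym; trans to ≈-trans)

    eval-rename : ∀ {x y} {X : Set x} {Y : Set y} (ρ : X → Y) (a : Y → Carrier) t →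
                  eval M a (renameTerm ρ t) ≈ eval M (a ∘ ρ) t
    eval-rename ρ a (var x)    = ≈-refl
    eval-rename ρ a (app F ts) = fun-cong F (λ i → eval-rename ρ a (ts i))

    ⊨-rename : ∀ {x y} {X : Set x} {Y : Set y} (ρ : X → Y) (a : Y → Carrier) φ →
               (M ⊨ rename ρ φ [ a ]) ⇔ (M ⊨ φ [ a ∘ ρ ])
    ⊨-rename ρ a (s ≐ t) = mk⇔
      (λ e → ≈-trans (≈-sym (eval-rename ρ a s)) (≈-trans e (eval-rename ρ a t)))
      (λ e → ≈-trans (eval-rename ρ a s) (≈-trans e (≈-sym (eval-rename ρ a t))))
    ⊨-rename ρ a (atom R ts) = mk⇔
      (rel-cong R (λ i → eval-rename ρ a (ts i)))
      (rel-cong R (λ i → ≈-sym (eval-rename ρ a (ts i))))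

  module _ {a c r d} {X : Set a} (D : Filter X r d) (M : Structure V c r)
           {y b} {Y : Set y} (B : Pred Y b) where
    private
      module M = Structure M
      M* = reducedPower D M
      module M* = Structure M*

    module _ {xs : Y → M*.Carrier} {as : X → Y → M.Carrier}
             (xs≈as : ∀ v → B v → xs v M*.≈ λ ξ → as ξ v) where

      eval-reducedPower : ∀ t → TermOver B t → eval M* xs t M*.≈ λ ξ → eval M (as ξ) t
      eval-reducedPower (var v)    b = xs≈as v b
      eval-reducedPower (app F ts) b = M*.fun-cong F (λ i → eval-reducedPower (ts i) (b i))

      -- The atomic case of Łoś's theorem. Arities are finite, so passing from `xs` to the D-equal
      -- values `as` takes only finite intersections, made by the congruence fields.
      ⊨-reducedPower : ∀ φ → AtomicOver B φ →
                       (M* ⊨ φ [ xs ]) ⇔ ((λ ξ → M ⊨ φ [ as ξ ]) ∈ Filter.sets D)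
      ⊨-reducedPower (s ≐ t) (bs , bt) = mk⇔
        (λ e → M*.trans (M*.sym (eval-reducedPower s bs)) (M*.trans e (eval-reducedPower t bt)))
        (λ e → M*.trans (eval-reducedPower s bs) (M*.trans e (M*.sym (eval-reducedPower t bt))))
      ⊨-reducedPower (atom R ts) b = mk⇔
        (M*.rel-cong R (λ i → eval-reducedPower (ts i) (b i)))
        (M*.rel-cong R (λ i → M*.sym (eval-reducedPower (ts i) (b i))))

module _ (em : ∀ {ℓ} → ExcludedMiddle ℓ) (ext : ∀ {a b} → Extensionality a b) where

  -- Classical choice and canonical representatives.

  stable : ∀ {a} {A : Set a} → ¬ ¬ A → A
  stable = decidable-stable em

  -- A choice function from excluded middle: the value supplied by `em` depends on the type `A`
  -- alone, and the argument only refutes the negative case.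
  select : ∀ {a} {A : Set a} → A → A
  select {A = A} x with em {P = A}
  ... | yes y = y
  ... | no ¬x = contradiction x ¬x

  select-constant : ∀ {a} {A : Set a} (x y : A) → select x ≡ select y
  select-constant {A = A} x y with em {P = A}
  ... | yes _ = refl
  ... | no ¬x = contradiction x ¬x

  -- Classes are given by characteristic functions into Bool, since equivalent
  -- propositions need not be equal types.
  module Representatives {c r} (S : Setoid c r) where
    open Setoid S renaming (refl to ≈-refl; sym to ≈-sym; trans to ≈-trans)

    χ : Carrier → Carrier → Bool
    χ x y = ⌊ em {P = x ≈ y} ⌋

    χ-cong : ∀ {x y} → x ≈ y → χ x ≡ χ y
    χ-cong x≈y = ext λ z →
      trans (isYes≗does em)
        (trans (does-⇔ (mk⇔ (≈-trans (≈-sym x≈y)) (≈-trans x≈y)) em em)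
               (sym (isYes≗does em)))

    member : ∀ x → ∃ (T ∘ χ x)
    member x = x , fromWitness ≈-refl

    rep : Carrier → Carrier
    rep x = proj₁ (select (member x))

    ≈-rep : ∀ x → x ≈ rep x
    ≈-rep x = toWitness (proj₂ (select (member x)))

    -- Related elements have equal characteristic functions, hence equal types of members, and
    -- `select` sees only the type. In `go` the two functions are variables so that their equality
    -- can be matched.
    rep-cong : ∀ {x y} → x ≈ y → rep x ≡ rep y
    rep-cong x≈y = go (χ-cong x≈y) _ _
      where
      go : ∀ {χ₁ χ₂ : Carrier → Bool} → χ₁ ≡ χ₂ → (m₁ : ∃ (T ∘ χ₁)) (m₂ : ∃ (T ∘ χ₂)) →
           proj₁ (select m₁) ≡ proj₁ (select m₂)
      go refl m₁ m₂ = cong proj₁ (select-constant m₁ m₂)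

  -- Well-orders: least elements and maxima.

  module Order {l} (L : WellOrder l) where
    open WellOrder L public
    open IsStrictTotalOrder isStrictTotalOrder public
      using (compare; asym; irrefl) renaming (trans to <-trans)

    Least : ∀ {ℓ} → Pred Carrier ℓ → Pred Carrier (l ⊔ ℓ)
    Least P x = P x × (∀ y → P y → ¬ y < x)

    least : ∀ {ℓ} (P : Pred Carrier ℓ) → ∃ P → ∃ (Least P)
    least P (x , Px) = All.wfRec wellFounded _ (λ x → P x → ∃ (Least P)) step x Px
      where
      step : ∀ x → (∀ {y} → y < x → P y → ∃ (Least P)) → P x → ∃ (Least P)
      step x rec Px with em {P = ∃[ y ] (y < x × P y)}
      ... | yes (y , y<x , Py) = rec y<x Py
      ... | no none            = x , Px , λ y Py y<x → none (y , y<x , Py)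

    ≮-<-trans : ∀ {x y z} → ¬ y < x → y < z → x < z
    ≮-<-trans {x} {y} y≮x y<z with compare x y
    ... | tri< x<y _ _  = <-trans x<y y<z
    ... | tri≈ _ refl _ = y<z
    ... | tri> _ _ y<x  = contradiction y<x y≮x

    ≮-antisym : ∀ {x y} → ¬ x < y → ¬ y < x → x ≡ y
    ≮-antisym {x} {y} x≮y y≮x with compare x y
    ... | tri< x<y _ _ = contradiction x<y x≮y
    ... | tri≈ _ x≡y _ = x≡y
    ... | tri> _ _ y<x = contradiction y<x y≮x

    max : Carrier → Carrier → Carrier
    max x y with compare x y
    ... | tri< _ _ _ = y
    ... | tri≈ _ _ _ = x
    ... | tri> _ _ _ = x

    max-lub : ∀ {x y z} → x < z → y < z → max x y < z
    max-lub {x} {y} x<z y<z with compare x y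
    ... | tri< _ _ _ = y<z
    ... | tri≈ _ _ _ = x<z
    ... | tri> _ _ _ = x<z

    max<⇒left< : ∀ {x y z} → max x y < z → x < z
    max<⇒left< {x} {y} m<z with compare x y
    ... | tri< x<y _ _ = <-trans x<y m<z
    ... | tri≈ _ _ _   = m<z
    ... | tri> _ _ _   = m<z

    max<⇒right< : ∀ {x y z} → max x y < z → y < z
    max<⇒right< {x} {y} m<z with compare x y
    ... | tri< _ _ _    = m<z
    ... | tri≈ _ refl _ = m<z
    ... | tri> _ _ y<x  = <-trans y<x m<z

  -- Regular uncountable cardinals and clubs of closure points.

  module Regular {l} (L : WellOrder l) (regularL : IsRegularCardinal L)
                 (ℕ≺L : ℕ ≺ WellOrder.Carrier L) where
    open Order L
    open IsRegularCardinal regularL using (infinite; regular)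

    bottom : ∃ (Least {l} U)
    bottom = least _ (Injection.to infinite 0 , tt)

    0# : Carrier
    0# = proj₁ bottom

    ≮0# : ∀ {x} → ¬ x < 0#
    ≮0# = proj₂ (proj₂ bottom) _ tt

    -- Regularity bounds a constant map strictly on any nonempty segment; of two distinct elements,
    -- the larger one provides such a segment.
    above : ∀ x → ∃[ y ] x < y
    above x with compare (Injection.to infinite 0) (Injection.to infinite 1)
    ... | tri< lt _ _ = _ , proj₂ (regular _ (const x)) _ lt
    ... | tri≈ _ eq _ = contradiction (Injection.injective infinite eq) λ ()
    ... | tri> _ _ gt = _ , proj₂ (regular _ (const x)) _ gt

    next : Carrier → Carrier
    next x = proj₁ (least (x <_) (above x))

    <-next : ∀ x → x < next x
    <-next x = proj₁ (proj₂ (least (x <_) (above x)))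

    next-minimal : ∀ {x y} → x < y → ¬ y < next x
    next-minimal {x} = proj₂ (proj₂ (least (x <_) (above x))) _

    next-injective : Injective _≡_ _≡_ next
    next-injective {x} {y} eq = ≮-antisym
      (λ x<y → next-minimal x<y (subst (y <_) (sym eq) (<-next y)))
      (λ y<x → next-minimal y<x (subst (x <_) eq (<-next x)))

    next≢0# : ∀ {x} → next x ≢ 0#
    next≢0# {x} eq = ≮0# (subst (x <_) eq (<-next x))

    fromℕ : ℕ → Carrier
    fromℕ zero    = 0#
    fromℕ (suc n) = next (fromℕ n)

    fromℕ-injective : ∀ m n → fromℕ m ≡ fromℕ n → m ≡ n
    fromℕ-injective zero    zero    _  = refl
    fromℕ-injective zero    (suc n) eq = contradiction (sym eq) next≢0#
    fromℕ-injective (suc m) zero    eq = contradiction eq next≢0#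
    fromℕ-injective (suc m) (suc n) eq = cong suc (fromℕ-injective m n (next-injective eq))

    ≮fromℕ⇒fromℕ : ∀ n {x} → ¬ fromℕ n < x → ∃[ m ] fromℕ m ≡ x
    ≮fromℕ⇒fromℕ zero    n≮x = 0 , ≮-antisym n≮x ≮0#
    ≮fromℕ⇒fromℕ (suc n) {x} sn≮x with em {P = fromℕ n < x}
    ... | yes n<x = suc n , ≮-antisym sn≮x (next-minimal n<x)
    ... | no  n≮x = ≮fromℕ⇒fromℕ n n≮x

    -- Uncountability enters here: if the finite ordinals had no strict bound, every element would
    -- be one of them, and `L` would inject into ℕ.
    fromℕ-bounded : ∃[ w ] (∀ n → fromℕ n < w)
    fromℕ-bounded = stable λ unbounded →
      let preimage = λ x →
            let n , n≮x = stable {A = ∃[ n ] (¬ fromℕ n < x)} λ none →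
                  unbounded (x , λ n → stable λ n≮x → none (n , n≮x))
            in ≮fromℕ⇒fromℕ n n≮x
      in proj₂ ℕ≺L (mk↣ {to = proj₁ ∘ preimage} λ {x} {y} eq →
           trans (sym (proj₂ (preimage x))) (trans (cong fromℕ eq) (proj₂ (preimage y))))

    -- `f` is read as a map on the finite ordinals and extended arbitrarily; these lie in a proper
    -- initial segment, so regularity applies.
    countable-bounded : ∀ (f : ℕ → Carrier) → ∃[ b ] (∀ n → f n < b)
    countable-bounded f = proj₁ bound , λ n →
        subst (_< proj₁ bound) (extend-fromℕ n)
          (proj₂ bound (fromℕ n) (proj₂ fromℕ-bounded n))
      where
      extend : Carrier → Carrier
      extend x with em {P = ∃[ n ] fromℕ n ≡ x}
      ... | yes (n , _) = f n
      ... | no _        = x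

      extend-fromℕ : ∀ n → extend (fromℕ n) ≡ f n
      extend-fromℕ n with em {P = ∃[ m ] fromℕ m ≡ fromℕ n}
      ... | yes (m , eq) = cong f (fromℕ-injective m n eq)
      ... | no none      = contradiction (n , refl) none

      bound = regular (proj₁ fromℕ-bounded) extend

    ClosedUnder : Carrier → (Carrier → Carrier → Carrier) → Pred Carrier l
    ClosedUnder c F δ = c < δ × (∀ i j → i < δ → j < δ → F i j < δ)

    -- Two arguments below a limit of closure points already lie below one closure point under that
    -- limit. For unboundedness, closing off ω times leads to a supremum that is a closure point.
    closedUnder-club : ∀ c F → IsClub L (ClosedUnder c F)
    closedUnder-club c F = closed , unbounded
      where
      closed : IsClosed L (ClosedUnder c F)
      closed δ (x , x<δ) limit =
        (let y , _ , y<δ , c<y , _ = limit x x<δ in <-trans c<y y<δ) ,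
        λ i j i<δ j<δ →
          let y , m<y , y<δ , _ , F<y = limit (max i j) (max-lub i<δ j<δ)
          in <-trans (F<y i j (max<⇒left< m<y) (max<⇒right< m<y)) y<δ

      -- Regularity is used twice: along each row, then for the bounds of the rows.
      image-bound : ∀ z → ∃[ b ] (∀ i j → i < z → j < z → F i j < b)
      image-bound z = proj₁ outer , λ i j i<z j<z →
          <-trans (proj₂ (regular z (F i)) j j<z) (proj₂ outer i i<z)
        where outer = regular z (λ i → proj₁ (regular z (F i)))

      enlarge : Carrier → Carrier
      enlarge z = next (max z (proj₁ (image-bound z)))

      <-enlarge : ∀ z → z < enlarge z
      <-enlarge z = max<⇒left< (<-next _)

      F<enlarge : ∀ z i j → i < z → j < z → F i j < enlarge z
      F<enlarge z i j i<z j<z =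
        <-trans (proj₂ (image-bound z) i j i<z j<z) (max<⇒right< {z} (<-next _))

      unbounded : IsUnbounded L (ClosedUnder c F)
      unbounded x = y , max<⇒left< start<y , max<⇒right< {x} start<y ,
          λ i j i<y j<y →
            -- As `y` is the least strict bound of `seq`, the smaller `max i j` is not one, so some
            -- `seq n` is at least `max i j`. One step of `enlarge` makes this strict, and a second
            -- captures `F i j`.
            let n , n≮m = stable λ none →
                  proj₂ (proj₂ supremum) (max i j)
                    (λ n → stable λ n≮m → none (n , n≮m)) (max-lub i<y j<y)
                m<sn = ≮-<-trans n≮m (<-enlarge (seq n))
            in <-trans (F<enlarge (seq (suc n)) i j (max<⇒left< m<sn) (max<⇒right< m<sn))
                       (seq<y (suc (suc n)))
        where
        seq : ℕ → Carrier
        seq zero    = max x c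
        seq (suc n) = enlarge (seq n)

        supremum : ∃ (Least (λ y → ∀ n → seq n < y))
        supremum = least _ (countable-bounded seq)

        y = proj₁ supremum
        seq<y = proj₁ (proj₂ supremum)
        start<y = seq<y 0

  -- Running a strategy against a prescribed sequence of moves.

  module _ {a c r c′ r′ v} {V : Vocabulary v} (A : WellOrder a)
           (M : Structure V c r) (N : Structure V c′ r′) where
    open EF A M N
    open Order A
    private
      module M = Structure M
      module N = Structure N

    Move : Set (c ⊔ c′)
    Move = M.Carrier ⊎ N.Carrier

    module Run (σ : Strategy) where
      open Strategy σ

      reply : ∀ i → History i → Move → Round
      reply i h (inj₁ x) = inM x (answerN i h x)
      reply i h (inj₂ y) = inN (answerM i h y) y

      reply-obeys : ∀ i h m → Obeys σ i h (reply i h m)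
      reply-obeys i h (inj₁ x) = lift N.refl
      reply-obeys i h (inj₂ y) = lift M.refl

      module _ (s : Carrier → Move) where
        step : ∀ i → (∀ {j} → j < i → Round) → Round
        step i rec = reply i (λ j j<i → rec j<i) (s i)

        run : Carrier → Round
        run = All.wfRec wellFounded _ (λ _ → Round) step

        run-unfold : ∀ i → run i ≡ reply i (λ j _ → run j) (s i)
        run-unfold i = FixPoint.unfold-wfRec wellFounded (λ _ → Round) step
          (λ i eq → cong (λ h → reply i h (s i)) (ext λ j → ext λ j<i → eq j<i))

        run-follows : Follows σ run
        run-follows i = subst (Obeys σ i (λ j _ → run j)) (sym (run-unfold i))
                              (reply-obeys i _ (s i))

      -- By induction, a round depends only on the moves up to it. This compares runs against
      -- schedules drawn up in different rounds of the long game.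
      run-local : ∀ {s s′ : Carrier → Move} i → (∀ j → j < i → s j ≡ s′ j) →
                  _≡_ {A = History i} (λ j _ → run s j) (λ j _ → run s′ j)
      run-local {s} {s′} i = All.wfRec wellFounded _
        (λ i → (∀ j → j < i → s j ≡ s′ j) →
               _≡_ {A = History i} (λ j _ → run s j) (λ j _ → run s′ j))
        (λ i rec s≡s′ → ext λ j → ext λ j<i →
          trans (run-unfold s j)
            (trans (cong₂ (reply j) (rec j<i (λ k k<j → s≡s′ k (<-trans k<j j<i))) (s≡s′ j j<i))
                   (sym (run-unfold s′ j))))
        i

  -- Transfer from λ to λ⁺: clubs in the filter and codes.

  module Transfer {l k v c c′ r d} (L : WellOrder l) (regularL : IsRegularCardinal L)
                  (ℕ≺L : ℕ ≺ WellOrder.Carrier L)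
                  (K : WellOrder k) (K-successor : IsSuccessorCardinal L K)
                  (D : Filter (WellOrder.Carrier L) r d) (D⊇clubs : ExtendsClubFilter L D)
                  {V : Vocabulary v} (M : Structure V c r) (N : Structure V c′ r) where
    private
      module L = Order L
      module K = Order K
      module M = Structure M
      module N = Structure N
      M* = reducedPower D M
      N* = reducedPower D N
      module M* = Structure M*
      module N* = Structure N*
      module RM = Representatives M*.setoid
      module RN = Representatives N*.setoid
    open Regular L regularL ℕ≺L
    open IsRegularCardinal regularL using (regular)
    open IsSuccessorCardinal K-successor using () renaming (above to L≺K; least to codes)
    open Filter D

    -- Filter elements live at level r; clubs defined through K need not.
    Resized : ∀ {ℓ} → Pred L.Carrier ℓ → Pred L.Carrier r
    Resized P ξ = Lift r (True (em {P = P ξ}))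

    resized : ∀ {ℓ} (P : Pred L.Carrier ℓ) {ξ} → P ξ → Resized P ξ
    resized P p = lift (fromWitness p)

    unresized : ∀ {ℓ} (P : Pred L.Carrier ℓ) {ξ} → Resized P ξ → P ξ
    unresized P (lift t) = toWitness t

    club∈D : ∀ {ℓ} (C : Pred L.Carrier ℓ) → IsClub L C → Resized C ∈ sets
    club∈D C (closed , unbounded) = D⊇clubs (Resized C)
      ( (λ δ nonzero limit → resized C (closed δ nonzero λ x x<δ →
          let y , x<y , y<δ , y∈C = limit x x<δ in y , x<y , y<δ , unresized C y∈C))
      , (λ x → let y , x<y , y∈C = unbounded x in y , x<y , resized C y∈C) )

    code : K.Carrier → K.Carrier → L.Carrier
    code α = proj₁ (codes α)

    code-injective : ∀ {α β γ} → β K.< α → γ K.< α → code α β ≡ code α γ → β ≡ γ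
    code-injective {α} = proj₂ (codes α)

    decode : K.Carrier → L.Carrier → K.Carrier
    decode α i with em {P = ∃[ γ ] (γ K.< α × code α γ ≡ i)}
    ... | yes (γ , _) = γ
    -- The default is not below `α`, so `ranksBelow` can recognise an `i` that codes nothing.
    ... | no _        = α

    decode-code : ∀ {α γ} → γ K.< α → decode α (code α γ) ≡ γ
    decode-code {α} {γ} γ<α with em {P = ∃[ β ] (β K.< α × code α β ≡ code α γ)}
    ... | yes (β , β<α , eq) = code-injective β<α γ<α eq
    ... | no none            = contradiction (γ , γ<α , refl) none

    -- If `α` were last, shifting the codes by `next` would free `0#` for `α` itself and inject λ⁺
    -- into λ.
    K-above : ∀ α → ∃[ β ] α K.< β
    K-above α = stable λ maximal → proj₂ L≺K (mk↣ (into-injective maximal))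
      where
      into : K.Carrier → L.Carrier
      into β with em {P = β K.< α}
      ... | yes _ = next (code α β)
      ... | no _  = 0#

      into-injective : ¬ (∃[ β ] α K.< β) → Injective _≡_ _≡_ into
      into-injective maximal {β} {γ} eq with em {P = β K.< α} | em {P = γ K.< α}
      ... | yes β<α | yes γ<α = code-injective β<α γ<α (next-injective eq)
      ... | yes _   | no _    = contradiction eq next≢0#
      ... | no _    | yes _   = contradiction (sym eq) next≢0#
      ... | no β≮α  | no γ≮α  =
        trans (K.≮-antisym β≮α (λ α<β → maximal (β , α<β)))
              (K.≮-antisym (λ α<γ → maximal (γ , α<γ)) γ≮α)

    K-bounded : ∀ n (f : Fin n → K.Carrier) → ∃[ α ] (∀ i → f i K.< α)
    K-bounded zero    f = Injection.to (proj₁ L≺K) 0# , λ ()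
    K-bounded (suc n) f =
      let α , f<α = K-bounded n (f ∘ suc)
          β , m<β = K-above (K.max (f zero) α)
      in β , λ { zero    → K.max<⇒left< m<β
               ; (suc i) → K.<-trans (f<α i) (K.max<⇒right< {f zero} m<β) }

    -- Remembered rounds and their ranks.

    Active : K.Carrier → L.Carrier → K.Carrier → Set (l ⊔ k)
    Active α ξ γ = γ K.< α × code α γ L.< ξ

    module _ (ξ : L.Carrier) where
      -- rank β is any strict bound of the earlier ranks, not an order type, so the
      -- ranks used at a coordinate may have gaps; schedule fills them with idle.
      ranksBelow : ∀ {β} → (∀ {γ} → γ K.< β → L.Carrier) → L.Carrier → L.Carrier
      ranksBelow {β} rec i with em {P = decode β i K.< β}
      ... | yes lt = rec lt
      ... | no _   = ξ

      rankStep : ∀ β → (∀ {γ} → γ K.< β → L.Carrier) → L.Carrier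
      rankStep β rec = proj₁ (regular ξ (ranksBelow rec))

      rank : K.Carrier → L.Carrier
      rank = All.wfRec K.wellFounded _ (λ _ → L.Carrier) rankStep

      rank-unfold : ∀ β → rank β ≡ rankStep β (λ {γ} _ → rank γ)
      rank-unfold β = FixPoint.unfold-wfRec K.wellFounded (λ _ → L.Carrier) rankStep
          (λ β eq → cong (λ f → proj₁ (regular ξ f)) (ext (ranksBelow-cong β eq)))
        where
        ranksBelow-cong : ∀ β {rec rec′ : ∀ {γ} → γ K.< β → L.Carrier} →
                          (∀ {γ} (γ<β : γ K.< β) → rec γ<β ≡ rec′ γ<β) →
                          ∀ i → ranksBelow rec i ≡ ranksBelow rec′ i
        ranksBelow-cong β eq i with em {P = decode β i K.< β}
        ... | yes lt = eq lt
        ... | no _   = refl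

      ranksBelow-code : ∀ {β γ} → γ K.< β →
                        ranksBelow {β} (λ {γ} _ → rank γ) (code β γ) ≡ rank γ
      ranksBelow-code {β} {γ} γ<β with em {P = decode β (code β γ) K.< β}
      ... | yes _ = cong rank (decode-code γ<β)
      ... | no ≮β = contradiction (subst (K._< β) (sym (decode-code γ<β)) γ<β) ≮β

      -- The codes of the rounds remembered in `β` lie below `ξ`, so regularity at `ξ` bounds all
      -- their ranks at once.
      rank-mono : ∀ {β γ} → Active β ξ γ → rank γ L.< rank β
      rank-mono {β} (γ<β , code<ξ) =
        subst₂ L._<_ (ranksBelow-code γ<β) (sym (rank-unfold β))
               (proj₂ (regular ξ (ranksBelow _)) _ code<ξ)

    -- Coherent coordinates.

    Coherent : K.Carrier → L.Carrier → Set (l ⊔ k)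
    Coherent α ξ = ∀ {β γ} → Active α ξ β → γ K.< β → Active α ξ γ ⇔ Active β ξ γ

    -- Coherence is closure of `ξ` under two operations on codes. `F₁` sends the `α`-codes of δ and
    -- γ to the δ-code of γ; `F₂` sends the `α`-code of δ and the δ-code of γ to the `α`-code of γ.
    -- Starting above `code α β` makes `β` remembered.
    coherent∈D : ∀ {α β} → β K.< α → Resized (λ ξ → Coherent α ξ × Active α ξ β) ∈ sets
    coherent∈D {α} {β} β<α =
        ⊆-closed (λ (in₁ , in₂) → resized (λ ξ → Coherent α ξ × Active α ξ β)
                                    (coherent (unresized C₁ in₁) (unresized C₂ in₂)))
                 (∩-closed (club∈D C₁ (closedUnder-club _ F₁)) (club∈D C₂ (closedUnder-club _ F₂)))
      where
      F₁ F₂ : L.Carrier → L.Carrier → L.Carrier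
      F₁ i j = code (decode α i) (decode α j)
      F₂ i j = code α (decode (decode α i) j)

      C₁ = ClosedUnder (code α β) F₁
      C₂ = ClosedUnder (code α β) F₂

      coherent : ∀ {ξ} → C₁ ξ → C₂ ξ → Coherent α ξ × Active α ξ β
      coherent {ξ} (c<ξ , closed₁) (_ , closed₂) =
        (λ {δ} {γ} (δ<α , δ<ξ) γ<δ → mk⇔
          (λ (γ<α , γ<ξ) → γ<δ ,
            subst₂ (λ δ γ → code δ γ L.< ξ) (decode-code δ<α) (decode-code γ<α)
                   (closed₁ _ _ δ<ξ γ<ξ))
          (λ (_ , γ<ξ) → K.<-trans γ<δ δ<α ,
            subst (λ γ → code α γ L.< ξ)
                  (trans (cong (λ δ → decode δ (code _ γ)) (decode-code δ<α)) (decode-code γ<δ))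
                  (closed₂ _ _ δ<ξ γ<ξ))) ,
        β<α , c<ξ

    -- By coherence the earlier of two remembered rounds is remembered in the later one, so
    -- `rank-mono` applies and trichotomy does the rest.
    rank-reflects-< : ∀ {α ξ β γ} → Coherent α ξ → Active α ξ β → Active α ξ γ →
                      rank ξ γ L.< rank ξ β → γ K.< β
    rank-reflects-< {α} {ξ} {β} {γ} coh aβ aγ lt with K.compare γ β
    ... | tri< γ<β _ _  = γ<β
    ... | tri≈ _ refl _ = contradiction lt (L.irrefl refl)
    ... | tri> _ _ β<γ  = contradiction lt (L.asym (rank-mono ξ (Equivalence.to (coh aγ β<γ) aβ)))

    rank-injective : ∀ {α ξ β γ} → Coherent α ξ → Active α ξ β → Active α ξ γ →
                     rank ξ β ≡ rank ξ γ → β ≡ γ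
    rank-injective {ξ = ξ} coh aβ aγ eq = K.≮-antisym
      (λ β<γ → L.irrefl eq (rank-mono ξ (Equivalence.to (coh aγ β<γ) aβ)))
      (λ γ<β → L.irrefl (sym eq) (rank-mono ξ (Equivalence.to (coh aβ γ<β) aγ)))

    -- A round later than all variables of an atomic formula.

    term-bounded : ∀ (t : Term V K.Carrier) → ∃[ α ] TermOver (K._< α) t
    terms-bounded : ∀ n (ts : Fin n → Term V K.Carrier) → ∃[ α ] (∀ i → TermOver (K._< α) (ts i))

    term-bounded (var β)    = K-above β
    term-bounded (app F ts) = terms-bounded _ ts

    terms-bounded n ts =
      let α , below = K-bounded n (λ i → proj₁ (term-bounded (ts i)))
      in α , λ i → TermOver-mono (λ β< → K.<-trans β< (below i)) (ts i) (proj₂ (term-bounded (ts i)))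

    atomic-bounded : ∀ (φ : Atomic V K.Carrier) → ∃[ α ] AtomicOver (K._< α) φ
    atomic-bounded (s ≐ t) =
      let α , s-below = term-bounded s
          β , t-below = term-bounded t
          γ , m<γ = K-above (K.max α β)
      in γ , TermOver-mono (λ δ<α → K.<-trans δ<α (K.max<⇒left< m<γ)) s s-below
           , TermOver-mono (λ δ<β → K.<-trans δ<β (K.max<⇒right< {α} m<γ)) t t-below
    atomic-bounded (atom R ts) = terms-bounded _ ts

    -- The strategy in the long game.

    module Γ  = EF L M N
    module Γ* = EF K M* N*

    Move* = Move K M* N*

    infix 8 _at_

    _at_ : Move* → L.Carrier → Move L M N
    inj₁ x at ξ = inj₁ (x ξ)
    inj₂ y at ξ = inj₂ (y ξ)

    canonical : Γ*.Round → Move*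
    canonical (Γ*.inM x _) = inj₁ (RM.rep x)
    canonical (Γ*.inN _ y) = inj₂ (RN.rep y)

    -- Equality modulo D becomes propositional equality, so histories of any length are compared by
    -- extensionality instead of one intersection per round.
    canonical-cong : ∀ {ρ ρ′} → ρ Γ*.≈ᴿ ρ′ → canonical ρ ≡ canonical ρ′
    canonical-cong (Γ*.inM x≈x′ _) = cong inj₁ (RM.rep-cong x≈x′)
    canonical-cong (Γ*.inN _ y≈y′) = cong inj₂ (RN.rep-cong y≈y′)

    Moves : K.Carrier → Set (l ⊔ k ⊔ c ⊔ c′)
    Moves α = ∀ γ → γ K.< α → Move*

    moves : ∀ {α} → Γ*.History α → Moves α
    moves h γ γ<α = canonical (h γ γ<α)

    module _ (σ : Γ.Strategy) (σ-wins : Γ.IsWinning σ) (idle : Move L M N) where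
      open Run L M N σ
      private module σ = Γ.Strategy σ

      -- Inverts `rank` on the remembered rounds. Where coherence fails a rank may be shared, and
      -- whichever round `em` supplies is taken.
      schedule : ∀ α → L.Carrier → Moves α → L.Carrier → Move L M N
      schedule α ξ m i with em {P = ∃[ γ ] (Active α ξ γ × rank ξ γ ≡ i)}
      ... | yes (γ , (γ<α , _) , _) = m γ γ<α at ξ
      ... | no _                    = idle

      position : ∀ α ξ → Moves α → Γ.History (rank ξ α)
      position α ξ m i _ = run (schedule α ξ m) i

      σ* : Γ*.Strategy
      σ* = record
        { answerN      = answerN
        ; answerM      = answerM
        ; answerN-cong = λ α {h} {h′} h≈h′ x≈x′ →
            N*.reflexive (cong₂ (answerN′ α) (moves-cong {α} {h} {h′} h≈h′) (RM.rep-cong x≈x′))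
        ; answerM-cong = λ α {h} {h′} h≈h′ y≈y′ →
            M*.reflexive (cong₂ (answerM′ α) (moves-cong {α} {h} {h′} h≈h′) (RN.rep-cong y≈y′))
        }
        where
        answerN′ : ∀ α → Moves α → M*.Carrier → N*.Carrier
        answerN′ α m x ξ = σ.answerN (rank ξ α) (position α ξ m) (x ξ)

        answerM′ : ∀ α → Moves α → N*.Carrier → M*.Carrier
        answerM′ α m y ξ = σ.answerM (rank ξ α) (position α ξ m) (y ξ)

        answerN : ∀ α → Γ*.History α → M*.Carrier → N*.Carrier
        answerN α h x = answerN′ α (moves h) (RM.rep x)

        answerM : ∀ α → Γ*.History α → N*.Carrier → M*.Carrier
        answerM α h y = answerM′ α (moves h) (RN.rep y)

        moves-cong : ∀ {α} {h h′ : Γ*.History α} → h Γ*.≈ᴴ h′ → moves h ≡ moves h′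
        moves-cong h≈h′ = ext λ γ → ext λ γ<α → canonical-cong (h≈h′ γ γ<α)

      localRound : ∀ {α} → Γ*.History α → Γ*.Round → L.Carrier → Γ.Round
      localRound {α} h ρ ξ = reply (rank ξ α) (position α ξ (moves h)) (canonical ρ at ξ)

      -- The element of I is D-equal to its representative, that of II to the answer of `σ*`; a
      -- single round needs only one such change.
      left-localRound : ∀ {α} h ρ → Γ*.Obeys σ* α h ρ →
                        Γ*.left ρ M*.≈ λ ξ → Γ.left (localRound h ρ ξ)
      left-localRound h (Γ*.inM x y) _        = RM.≈-rep x
      left-localRound h (Γ*.inN x y) (lift x≈) = x≈

      right-localRound : ∀ {α} h ρ → Γ*.Obeys σ* α h ρ →
                         Γ*.right ρ N*.≈ λ ξ → Γ.right (localRound h ρ ξ)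
      right-localRound h (Γ*.inM x y) (lift y≈) = y≈
      right-localRound h (Γ*.inN x y) _        = RN.≈-rep y

      module _ (μ : K.Carrier → Move*) where
        scheduleOf : K.Carrier → L.Carrier → L.Carrier → Move L M N
        scheduleOf α ξ = schedule α ξ (λ γ _ → μ γ)

        schedule-active : ∀ {α ξ β} → Coherent α ξ → Active α ξ β →
                          scheduleOf α ξ (rank ξ β) ≡ μ β at ξ
        schedule-active {α} {ξ} {β} coh aβ
          with em {P = ∃[ γ ] (Active α ξ γ × rank ξ γ ≡ rank ξ β)}
        ... | yes (γ , aγ , eq) = cong (λ δ → μ δ at ξ) (rank-injective coh aγ aβ eq)
        ... | no none           = contradiction (β , aβ , refl) none

        -- A round remembered in `β` is remembered in `α` by coherence. Conversely, one remembered
        -- in `α` with rank below that of `β` precedes `β`, hence is remembered in `β`. So both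
        -- schedules find the same round or both idle.
        schedule-coherent : ∀ {α ξ β} → Coherent α ξ → Active α ξ β → ∀ i → i L.< rank ξ β →
                            scheduleOf β ξ i ≡ scheduleOf α ξ i
        schedule-coherent {α} {ξ} {β} coh aβ i i<
          with em {P = ∃[ γ ] (Active β ξ γ × rank ξ γ ≡ i)}
             | em {P = ∃[ γ ] (Active α ξ γ × rank ξ γ ≡ i)}
        ... | yes (γ , γβ , eq) | yes (δ , δα , eq′) =
          cong (λ δ → μ δ at ξ)
            (rank-injective coh (Equivalence.from (coh aβ (proj₁ γβ)) γβ) δα (trans eq (sym eq′)))
        ... | yes (γ , γβ , eq) | no none =
          contradiction (γ , Equivalence.from (coh aβ (proj₁ γβ)) γβ , eq) none
        ... | no none | yes (δ , δα , refl) =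
          contradiction (δ , Equivalence.to (coh aβ (rank-reflects-< coh aβ δα i<)) δα , refl) none
        ... | no _ | no _ = refl

        -- The run reconstructed in round `α` passes through the very round that II computed at `ξ`
        -- in round `β`.
        run-active : ∀ {α ξ β} → Coherent α ξ × Active α ξ β →
                     run (scheduleOf α ξ) (rank ξ β) ≡
                     reply (rank ξ β) (position β ξ (λ γ _ → μ γ)) (μ β at ξ)
        run-active (coh , aβ) =
          trans (run-unfold _ _)
            (cong₂ (reply _)
              (run-local _ (λ i i< → sym (schedule-coherent coh aβ i i<)))
              (schedule-active coh aβ))

      σ*-wins : Γ*.IsWinning σ*
      σ*-wins p follows φ =
          ⇔-sym (⊨-reducedPower D N (K._< α) right≈ φ φ-below)
          ⇔-∘ (mk⇔ (⊆-closed (λ {ξ} → Equivalence.to (local ξ)))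
                   (⊆-closed (λ {ξ} → Equivalence.from (local ξ)))
          ⇔-∘ ⊨-reducedPower D M (K._< α) left≈ φ φ-below)
        where
        α = proj₁ (atomic-bounded φ)
        φ-below = proj₂ (atomic-bounded φ)

        μ : K.Carrier → Move*
        μ = canonical ∘ p

        localPlay : L.Carrier → Γ.Play
        localPlay ξ = run (scheduleOf μ α ξ)

        -- The exceptional coordinates may vary with `β`; this is harmless, as `φ` mentions finitely
        -- many rounds.
        localPlay≡ : ∀ {β} → β K.< α → Resized (λ ξ →
                       localRound (λ γ _ → p γ) (p β) ξ ≡ localPlay ξ (rank ξ β)) ∈ sets
        localPlay≡ {β} β<α = ⊆-closed
          (λ {ξ} good → resized (λ ξ → localRound (λ γ _ → p γ) (p β) ξ ≡ localPlay ξ (rank ξ β))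
            (sym (run-active μ (unresized (λ ξ → Coherent α ξ × Active α ξ β) good))))
          (coherent∈D β<α)

        left≈ : ∀ β → β K.< α → Γ*.left (p β) M*.≈ λ ξ → Γ.left (localPlay ξ (rank ξ β))
        left≈ β β<α = M*.trans (left-localRound _ (p β) (follows β))
          (⊆-closed (λ t → M.reflexive (cong Γ.left (toWitness (lower t)))) (localPlay≡ β<α))

        right≈ : ∀ β → β K.< α → Γ*.right (p β) N*.≈ λ ξ → Γ.right (localPlay ξ (rank ξ β))
        right≈ β β<α = N*.trans (right-localRound _ (p β) (follows β))
          (⊆-closed (λ t → N.reflexive (cong Γ.right (toWitness (lower t)))) (localPlay≡ β<α))

        -- Holds even at incoherent `ξ`, since every `localPlay ξ` follows `σ`. Renaming along
        -- `rank ξ` turns `φ` into a formula about rounds of the short game.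
        local : ∀ ξ → (M ⊨ φ [ Γ.left ∘ localPlay ξ ∘ rank ξ ]) ⇔
                      (N ⊨ φ [ Γ.right ∘ localPlay ξ ∘ rank ξ ])
        local ξ =
          ⊨-rename N (rank ξ) _ φ
          ⇔-∘ (σ-wins (localPlay ξ) (run-follows _) (rename (rank ξ) φ)
          ⇔-∘ ⇔-sym (⊨-rename M (rank ξ) _ φ))

    transfer : EFEquivalent L M N → EFEquivalent K M* N*
    transfer (σ , σ-wins) with em {P = Move L M N}
    ... | yes idle = σ* σ σ-wins idle , σ*-wins σ σ-wins idle
    -- Both structures are empty here. An element of a reduced power, evaluated at `0#`, would be a
    -- move, so there is nothing to answer and no play to win.
    ... | no empty = record
        { answerN      = λ _ _ x → contradiction (inj₁ (x 0#)) empty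
        ; answerM      = λ _ _ y → contradiction (inj₂ (y 0#)) empty
        ; answerN-cong = λ _ {x = x} _ _ → contradiction (inj₁ (x 0#)) empty
        ; answerM-cong = λ _ {y = y} _ _ → contradiction (inj₂ (y 0#)) empty
        } , λ p _ → contradiction (inj₁ (Γ*.left (p (Injection.to (proj₁ L≺K) 0#)) 0#)) empty

theorem1 : (∀ {ℓ} → ExcludedMiddle ℓ) →
    (∀ {a b} → Extensionality a b) →
    ∀ {l k v c c′ r d}
    (L : WellOrder l) → IsRegularCardinal L → ℕ ≺ WellOrder.Carrier L →
    (L⁺ : WellOrder k) → IsSuccessorCardinal L L⁺ →
    (D : Filter (WellOrder.Carrier L) r d) → ExtendsClubFilter L D →
    (V : Vocabulary v) (M : Structure V c r) (N : Structure V c′ r) →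
    EFEquivalent L M N →
    EFEquivalent L⁺ (reducedPower D M) (reducedPower D N)
theorem1 em ext L regularL ℕ≺L L⁺ L⁺-successor D D⊇clubs V M N =
  Transfer.transfer em ext L regularL ℕ≺L L⁺ L⁺-successor D D⊇clubs M N
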